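{- $\mathrm{FO}[\leq, \mathrm{fin}]$ cannot sum through beyond a constant; that is, for every nondecreasing unbounded function $f\colon \mathbb{N} \to \mathbb{N}$ with $f(n) \leq n$ for all $n$, the logic $\mathrm{FO}[\leq, \mathrm{fin}]$ cannot sum through $f(n)$.
   Context: Notation: $\mathbb{N} = \{0,1,2,\ldots\}$ and $[n] = \{0,1,\ldots,n-1\}$. A function $f\colon\mathbb{N}\to\mathbb{N}$ is nondecreasing if $m > n$ implies $f(m) \geq f(n)$. Logic on words: for a finite alphabet $A$, let $\sigma_A = \{\mathbf{a} \mid a \in A\}$ be a vocabulary of unary letter predicates. A word $u = u_0u_1\cdots u_{n-1} \in A^*$ is identified with the structure with universe $[n]$ in which $\mathbf{a}$ is interpreted as the set of positions $i$ with $u_i = a$. A numerical predicate is a $k$-ary relation symbol together with, for each universe size $n$, an interpretation which is a subset of $[n]^k$. It is unvaried if there is a set $E \subseteq \mathbb{N}^k$ such that its interpretation on universes of size $n$ is $E \cap [n]^k$ for every $n$; it is then identified with $E$. An unvaried predicate $P \subseteq \mathbb{N}^k$ is of finite degree if every $n \in \mathbb{N}$ appears in only finitely many tuples of $P$; $\mathrm{fin}$ is the class of all finite-degree predicates (of all arities). For a formula $\phi$ using numerical predicates, $u \models \phi$ means that $\phi$ is true in the structure of $u$ augmented with the interpretations of the numerical predicates for universe size $|u|$; free variables are assigned positions in $[|u|]$. $\mathrm{FO}[\leq,\mathrm{fin}]$ is the set of first-order formulas built using the order $\leq$, the predicates in $\mathrm{fin}$, and the letter predicates, for any alphabet $A$.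 For a nondecreasing function $f$ with $f(n) \leq n$, a logic sums through $f(n)$ if there is a formula $\phi(a,b,c)$ in this logic such that for all $n$ and all $w \in \{0,1\}^n$ (and all values of $a,b,c$ in the universe $[n]$): \[w \models \phi(a,b,c) \Leftrightarrow a = b + f(c).\] -}

module Defs where

open import Data.Empty using (⊥)
open import Data.Fin using (Fin; toℕ)
open import Data.List using (List)
import Data.List.Membership.Propositional as List
open import Data.Nat using (ℕ; suc; _+_; _≤_; _<_; _≥_; _>_)
open import Data.Product using (_×_; ∃-syntax; Σ-syntax)
open import Data.Sum using (_⊎_)
open import Data.Unit using (⊤)
open import Data.Vec using (Vec; []; _∷_; lookup; map)
import Data.Vec.Membership.Propositional as Vec
open import Function.Bundles using (_⇔_)
open import Level using (0ℓ)
open import Relation.Binary.PropositionalEquality using (_≡_)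
open import Relation.Nullary using (¬_)
open import Relation.Unary using (Pred)

Nondecreasing : (ℕ → ℕ) → Set
Nondecreasing f = ∀ {m n} → m > n → f m ≥ f n

Unbounded : (ℕ → ℕ) → Set
Unbounded f = ∀ m → ∃[ n ] m < f n

-- An unvaried numerical predicate is identified with the set E ⊆ ℕᵏ; it need
-- not be decidable.
UnvariedPredicate : ℕ → Set₁
UnvariedPredicate k = Pred (Vec ℕ k) 0ℓ

PredicateClass : Set₁
PredicateClass = ∀ k → Pred (UnvariedPredicate k) 0ℓ

-- Every n appears, as some coordinate, in only finitely many tuples of E: those
-- tuples can be listed (the list may contain further tuples and repetitions).
FiniteDegree : ∀ {k} → UnvariedPredicate k → Set
FiniteDegree {k} E =
  ∀ n → ∃[ ts ] (∀ (t : Vec ℕ k) → E t → n Vec.∈ t → t List.∈ ts)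

fin : PredicateClass
fin k = FiniteDegree

infix  8 _≼_ _≐_
infix  7 ¬′_
infixr 6 _∧′_
infixr 5 _∨′_
infixr 4 _⇒′_

-- First-order formulas over the alphabet Fin s with free variables in Fin v
-- (de Bruijn indices: a quantifier binds variable zero of its body).
data FO[≤,_] (𝒩 : PredicateClass) (s : ℕ) (v : ℕ) : Set₁ where
  ⊤′ ⊥′          : FO[≤, 𝒩 ] s v
  letter         : Fin s → Fin v → FO[≤, 𝒩 ] s v
  _≼_ _≐_        : Fin v → Fin v → FO[≤, 𝒩 ] s v
  pred           : ∀ {k} (E : UnvariedPredicate k) → 𝒩 k E → Vec (Fin v) k → FO[≤, 𝒩 ] s v
  ¬′_            : FO[≤, 𝒩 ] s v → FO[≤, 𝒩 ] s v
  _∧′_ _∨′_ _⇒′_ : FO[≤, 𝒩 ] s v → FO[≤, 𝒩 ] s v → FO[≤, 𝒩 ] s v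
  ∃′ ∀′          : FO[≤, 𝒩 ] s (suc v) → FO[≤, 𝒩 ] s v

Word : ℕ → ℕ → Set
Word s n = Vec (Fin s) n

infix 3 _,_⊨_

-- The universe of w is Fin n, so E is interpreted as E ∩ [n]ᵏ.
_,_⊨_ : ∀ {𝒩 s v n} → Word s n → Vec (Fin n) v → FO[≤, 𝒩 ] s v → Set
w , ρ ⊨ ⊤′          = ⊤
w , ρ ⊨ ⊥′          = ⊥
w , ρ ⊨ letter a x  = lookup w (lookup ρ x) ≡ a
w , ρ ⊨ x ≼ y       = toℕ (lookup ρ x) ≤ toℕ (lookup ρ y)
w , ρ ⊨ x ≐ y       = lookup ρ x ≡ lookup ρ y
w , ρ ⊨ pred E _ xs = E (map (λ x → toℕ (lookup ρ x)) xs)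
w , ρ ⊨ ¬′ φ        = ¬ (w , ρ ⊨ φ)
w , ρ ⊨ φ ∧′ ψ      = (w , ρ ⊨ φ) × (w , ρ ⊨ ψ)
w , ρ ⊨ φ ∨′ ψ      = (w , ρ ⊨ φ) ⊎ (w , ρ ⊨ ψ)
w , ρ ⊨ φ ⇒′ ψ      = (w , ρ ⊨ φ) → (w , ρ ⊨ ψ)
w , ρ ⊨ ∃′ φ        = ∃[ i ] (w , i ∷ ρ ⊨ φ)
w , ρ ⊨ ∀′ φ        = ∀ i → (w , i ∷ ρ ⊨ φ)

FO[≤,_]SumsThrough_ : PredicateClass → (ℕ → ℕ) → Set₁
FO[≤, 𝒩 ]SumsThrough f =
  Σ[ φ ∈ FO[≤, 𝒩 ] 2 3 ] (∀ n (w : Word 2 n) (a b c : Fin n) →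
    (w , a ∷ b ∷ c ∷ [] ⊨ φ) ⇔ (toℕ a ≡ toℕ b + f (toℕ c)))

{-# OPTIONS --safe #-}
-- On a constant word, a formula φ cannot tell c from c′ when two
-- other variables a and b lie far beyond both. A finite-degree predicate holding
-- of a tuple with an entry at most m has all its entries below a bound depending
-- on m only, so thresholds N 0 ≤ N 1 ≤ … can be chosen such that no predicate of φ
-- relates an element up to N i to one beyond N (i + 1). In an Ehrenfeucht–Fraïssé
-- game the variables are then split into low ones (up to N lo) and high ones
-- (beyond N hi). A move up to the middle threshold joins the low variables, any
-- other move joins the high ones and is copied. The low variables matter only
-- through a type, and the number of types depends on φ alone, not on N or on
-- the universe. By pigeonhole two elements c and c′ with f c < f c′ have the same
-- type; with b far away, a = b + f c then gives a = b + f c′.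
module Submission where

open import Data.Fin using (Fin; zero; suc; toℕ; fromℕ<; combine; funToFin; finToFun; _≟_)
open import Data.Fin.Properties
  using (any?; combine-injectiveˡ; combine-injectiveʳ; finToFun-funToFin; pigeonhole;
         sequence; toℕ-fromℕ<; toℕ-injective; toℕ<n)
open import Data.List using (List; concatMap; upTo)
open import Data.List.Extrema.Nat using (max; xs≤max)
open import Data.List.Membership.Propositional.Properties using (∈-concatMap⁺; ∈-upTo⁺)
import Data.List.Relation.Unary.All as All
import Data.List.Relation.Unary.Any as Any
open import Data.Nat using (ℕ; zero; suc; _+_; _*_; _^_; _≤_; _<_; _≤′_; z≤n; s≤s; ≤′-refl; ≤′-step; _≤?_)
open import Data.Nat.Properties
  using (+-cancelˡ-≡; +-comm; +-assoc; +-monoʳ-≤; <-irrefl; <-≤-trans; <⇒≤; m≤m+n; m≤n+m;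
         n<1+n; ≤-antisym; ≤-refl; ≤-reflexive; ≤-trans; ≤-<-trans; ≤⇒≤′; ≮⇒≥; ≰⇒>)
open import Data.Product using (_×_; _,_; ∃-syntax; Σ-syntax; proj₁; proj₂; map₂)
open import Data.Sum using (_⊎_; inj₁; inj₂)
open import Data.Vec using (Vec; []; _∷_; lookup; map; replicate; toList)
import Data.Vec.Membership.Propositional as Vec
open import Data.Vec.Membership.Propositional.Properties using (∈-map⁺; ∈-toList⁺)
open import Data.Vec.Properties using (lookup-replicate)
open import Data.Vec.Relation.Unary.Any using (here; there)
open import Effect.Monad using (RawMonad)
open import Function.Base using (_∘_)
open import Function.Bundles using (Equivalence)
open import Relation.Binary.PropositionalEquality
  using (_≡_; refl; sym; trans; cong; cong₂; subst)
open import Relation.Nullary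
  using (¬_; Dec; yes; no; contradiction; _×-dec_)
open import Relation.Nullary.Decidable using (¬¬-excluded-middle)
open import Relation.Nullary.Negation using (¬¬-Monad; ¬¬-map)
open import Defs

-- Monotone sequences, double negation and finite codes

step-mono⇒mono : ∀ {h : ℕ → ℕ} → (∀ i → h i ≤ h (suc i)) → ∀ {i j} → i ≤ j → h i ≤ h j
step-mono⇒mono {h} step i≤j = go (≤⇒≤′ i≤j)
  where
  go : ∀ {i j} → i ≤′ j → h i ≤ h j
  go ≤′-refl       = ≤-refl
  go (≤′-step i≤j) = ≤-trans (go i≤j) (step _)

step-mono⇒mono-< : ∀ {h : ℕ → ℕ} → (∀ i → h i < h (suc i)) → ∀ {i j} → i < j → h i < h j
step-mono⇒mono-< step i<j = <-≤-trans (step _) (step-mono⇒mono (<⇒≤ ∘ step) i<j)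

-- This double-negation shift works because the vectors range over a finite set; it is applied one
-- coordinate at a time.
¬¬-∀-Vec : ∀ {n v} {P : Vec (Fin n) v → Set} → (∀ ρ → ¬ ¬ P ρ) → ¬ ¬ (∀ ρ → P ρ)
¬¬-∀-Vec {v = zero}  ¬¬P = ¬¬-map (λ { p [] → p }) (¬¬P [])
¬¬-∀-Vec {v = suc v} ¬¬P =
  ¬¬-map (λ { p (i ∷ ρ) → p i ρ })
    (sequence (RawMonad.rawApplicative ¬¬-Monad) λ i → ¬¬-∀-Vec λ ρ → ¬¬P (i ∷ ρ))

map-cong-∈ : ∀ {A B : Set} {k} {f g : A → B} (xs : Vec A k) →
  (∀ {x} → x Vec.∈ xs → f x ≡ g x) → map f xs ≡ map g xs
map-cong-∈ []       f≡g = refl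
map-cong-∈ (x ∷ xs) f≡g = cong₂ _∷_ (f≡g (here refl)) (map-cong-∈ xs (f≡g ∘ there))

truthValue : ∀ {A : Set} → Dec A → Fin 2
truthValue (yes _) = suc zero
truthValue (no _)  = zero

truthValue-transfer : ∀ {A B : Set} (a? : Dec A) (b? : Dec B) →
  truthValue a? ≡ truthValue b? → A → B
truthValue-transfer (yes _) (yes b) _ _ = b
truthValue-transfer (no ¬a) _       _ a = contradiction a ¬a

funToFin-injective : ∀ {m n} {f g : Fin m → Fin n} → funToFin f ≡ funToFin g → ∀ i → f i ≡ g i
funToFin-injective {f = f} {g} eq i =
  trans (sym (finToFun-funToFin f i))
        (trans (cong (λ k → finToFun k i) eq) (finToFun-funToFin g i))

-- Degree bounds and the measures of a formula

neighbours : ∀ {k} {E : UnvariedPredicate k} → FiniteDegree E → ℕ → List ℕ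
neighbours finite n = concatMap toList (proj₁ (finite n))

degreeBound : ∀ {k} {E : UnvariedPredicate k} → FiniteDegree E → ℕ → ℕ
degreeBound finite m = max 0 (concatMap (neighbours finite) (upTo (suc m)))

degreeBound-correct : ∀ {k} {E : UnvariedPredicate k} (finite : FiniteDegree E) {m i j t} →
  E t → i Vec.∈ t → i ≤ m → j Vec.∈ t → j ≤ degreeBound finite m
degreeBound-correct finite {m} {i} {j} {t} Et i∈t i≤m j∈t =
  All.lookup (xs≤max 0 _)
    (∈-concatMap⁺ (neighbours finite) (Any.map
      (λ { refl → ∈-concatMap⁺ toList (Any.map (λ { refl → ∈-toList⁺ j∈t }) (proj₂ (finite i) t Et i∈t)) })
      (∈-upTo⁺ (s≤s i≤m))))

-- Sums stand in for maxima: a threshold that exceeds the sum exceeds the reach of both operands.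
reach : ∀ {s v} → FO[≤, fin ] s v → ℕ → ℕ
reach ⊤′                m = 0
reach ⊥′                m = 0
reach (letter a x)      m = 0
reach (x ≼ y)           m = 0
reach (x ≐ y)           m = 0
reach (pred E finite _) m = degreeBound finite m
reach (¬′ φ)            m = reach φ m
reach (φ ∧′ ψ)          m = reach φ m + reach ψ m
reach (φ ∨′ ψ)          m = reach φ m + reach ψ m
reach (φ ⇒′ ψ)          m = reach φ m + reach ψ m
reach (∃′ φ)            m = reach φ m
reach (∀′ φ)            m = reach φ m

-- The number of thresholds that must separate the low from the high variables;
-- a quantifier doubles it because its cut halves the interval.
gap : ∀ {𝒩 s v} → FO[≤, 𝒩 ] s v → ℕ
gap ⊤′            = 1
gap ⊥′            = 1
gap (letter a x)  = 1
gap (x ≼ y)       = 1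
gap (x ≐ y)       = 1
gap (pred E _ xs) = 1
gap (¬′ φ)        = gap φ
gap (φ ∧′ ψ)      = gap φ + gap ψ
gap (φ ∨′ ψ)      = gap φ + gap ψ
gap (φ ⇒′ ψ)      = gap φ + gap ψ
gap (∃′ φ)        = gap φ + gap φ
gap (∀′ φ)        = gap φ + gap φ

-- For a quantifier: the set of types reachable by a low move, and the type after
-- a high move.
types : ∀ {𝒩 s v} → FO[≤, 𝒩 ] s v → ℕ
types ⊤′            = 1
types ⊥′            = 1
types (letter a x)  = 1
types (x ≼ y)       = 2
types (x ≐ y)       = 2 * 2
types (pred E _ xs) = 2
types (¬′ φ)        = types φ
types (φ ∧′ ψ)      = types φ * types ψ
types (φ ∨′ ψ)      = types φ * types ψ
types (φ ⇒′ ψ)      = types φ * types ψ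
types (∃′ φ)        = 2 ^ types φ * types φ
types (∀′ φ)        = 2 ^ types φ * types φ

-- The game on a constant word

module Game {s n : ℕ} (w : Word s n) (constant : ∀ i j → lookup w i ≡ lookup w j) (junk : Fin n)
            (N : ℕ → ℕ) (N-step : ∀ i → N i ≤ N (suc i)) where

  N-mono : ∀ {i j} → i ≤ j → N i ≤ N j
  N-mono = step-mono⇒mono N-step

  -- In Placed lo hi p p′ q q′, a variable has value p in one play and p′ in the
  -- other; the types see q and q′ instead, which are arbitrary for a high variable.
  data Placed (lo hi : ℕ) : (p p′ q q′ : Fin n) → Set where
    low  : ∀ {p p′} → toℕ p ≤ N lo → toℕ p′ ≤ N lo → Placed lo hi p p′ p p′
    high : ∀ {p q q′} → N hi < toℕ p → Placed lo hi p p q q′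

  AllPlaced : ∀ {v} (lo hi : ℕ) (ρ ρ′ σ σ′ : Vec (Fin n) v) → Set
  AllPlaced lo hi ρ ρ′ σ σ′ =
    ∀ x → Placed lo hi (lookup ρ x) (lookup ρ′ x) (lookup σ x) (lookup σ′ x)

  Placed-sym : ∀ {lo hi p p′ q q′} → Placed lo hi p p′ q q′ → Placed lo hi p′ p q′ q
  Placed-sym (low p≤ p′≤) = low p′≤ p≤
  Placed-sym (high <p)    = high <p

  Placed-narrow : ∀ {lo hi lo′ hi′ p p′ q q′} → lo ≤ lo′ → hi′ ≤ hi →
    Placed lo hi p p′ q q′ → Placed lo′ hi′ p p′ q q′
  Placed-narrow lo≤ hi≥ (low p≤ p′≤) = low (≤-trans p≤ (N-mono lo≤)) (≤-trans p′≤ (N-mono lo≤))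
  Placed-narrow lo≤ hi≥ (high <p)    = high (≤-<-trans (N-mono hi≥) <p)

  AllPlaced-∷ : ∀ {lo hi lo′ hi′ v p p′ q q′} {ρ ρ′ σ σ′ : Vec (Fin n) v} →
    lo ≤ lo′ → hi′ ≤ hi → Placed lo′ hi′ p p′ q q′ → AllPlaced lo hi ρ ρ′ σ σ′ →
    AllPlaced lo′ hi′ (p ∷ ρ) (p′ ∷ ρ′) (q ∷ σ) (q′ ∷ σ′)
  AllPlaced-∷ lo≤ hi≥ pl pls zero    = pl
  AllPlaced-∷ lo≤ hi≥ pl pls (suc x) = Placed-narrow lo≤ hi≥ (pls x)

  Placed-split : ∀ {lo hi p p′ q q′} → Placed lo hi p p′ q q′ → toℕ p ≤ N lo ⊎ N hi < toℕ p
  Placed-split (low p≤ _) = inj₁ p≤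
  Placed-split (high <p)  = inj₂ <p

  Placed-≤ : ∀ {lo hi p p′ q q′} → Placed lo hi p p′ q q′ → toℕ p ≤ N hi → p ≡ q × p′ ≡ q′
  Placed-≤ (low _ _) _  = refl , refl
  Placed-≤ (high <p) p≤ = contradiction (<-≤-trans <p p≤) (<-irrefl refl)

  Placed-> : ∀ {lo hi p p′ q q′} → Placed lo hi p p′ q q′ → N lo < toℕ p → p ≡ p′
  Placed-> (low p≤ _) <p = contradiction (<-≤-trans <p p≤) (<-irrefl refl)
  Placed-> (high _)   _  = refl

  -- Two low elements are compared through the types, two high ones are the same in both plays, and
  -- between a low and a high one the thresholds fix the order.
  Placed-≼ : ∀ {lo hi p₁ p₁′ q₁ q₁′ p₂ p₂′ q₂ q₂′} → lo ≤ hi →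
    Placed lo hi p₁ p₁′ q₁ q₁′ → Placed lo hi p₂ p₂′ q₂ q₂′ →
    (toℕ q₁ ≤ toℕ q₂ → toℕ q₁′ ≤ toℕ q₂′) → toℕ p₁ ≤ toℕ p₂ → toℕ p₁′ ≤ toℕ p₂′
  Placed-≼ lo≤hi (low _ _)   (low _ _)  q≤ p≤ = q≤ p≤
  Placed-≼ lo≤hi (low _ p′≤) (high <p)  q≤ p≤ = ≤-trans p′≤ (≤-trans (N-mono lo≤hi) (<⇒≤ <p))
  Placed-≼ lo≤hi (high <p)   (low p≤ _) q≤ p≤′ =
    contradiction (<-≤-trans <p (≤-trans p≤′ (≤-trans p≤ (N-mono lo≤hi)))) (<-irrefl refl)
  Placed-≼ lo≤hi (high _)    (high _)   q≤ p≤ = p≤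

  Separated : ∀ {v} → FO[≤, fin ] s v → Set
  Separated φ = ∀ i → reach φ (N i) ≤ N (suc i)

  -- One implication suffices, as `Placed-sym` exchanges the two plays.
  Classifies : ∀ {v K} → FO[≤, fin ] s v → (lo hi : ℕ) → (Vec (Fin n) v → Fin K) → Set
  Classifies φ lo hi κ = ∀ {ρ ρ′ σ σ′} → AllPlaced lo hi ρ ρ′ σ σ′ → κ σ ≡ κ σ′ →
    w , ρ ⊨ φ → w , ρ′ ⊨ φ

  -- In a tuple of `E`, an entry up to `N lo` keeps all entries up to `N hi`, so none is high and
  -- the types see the true values. An entry beyond `N hi` keeps all entries beyond `N lo`, so both
  -- plays have the same tuple. The first entry decides between the cases.
  Placed-pred : ∀ {v k lo hi} {E : UnvariedPredicate k} (finite : FiniteDegree E)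
    (xs : Vec (Fin v) k) → Separated (pred E finite xs) → suc lo ≤ hi →
    ∀ {ρ ρ′ σ σ′} → AllPlaced lo hi ρ ρ′ σ σ′ →
    (w , σ ⊨ pred {𝒩 = fin} E finite xs → w , σ′ ⊨ pred {𝒩 = fin} E finite xs) →
    w , ρ ⊨ pred {𝒩 = fin} E finite xs → w , ρ′ ⊨ pred {𝒩 = fin} E finite xs
  Placed-pred finite [] sep lo<hi pl Eσ Eρ = Eρ
  Placed-pred {lo = lo} {hi} {E} finite xs@(x ∷ _) sep lo<hi {ρ} {ρ′} {σ} {σ′} pl Eσ Eρ
    with Placed-split (pl x)
  ... | inj₁ x≤ = subst E (sym (cong-∈ ρ′ σ′ (proj₂ ∘ eqs)))
                    (Eσ (subst E (cong-∈ ρ σ (proj₁ ∘ eqs)) Eρ))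
    where
    cong-∈ : ∀ (τ υ : Vec (Fin n) _) → (∀ {y} → y Vec.∈ xs → lookup τ y ≡ lookup υ y) →
      map (λ y → toℕ (lookup τ y)) xs ≡ map (λ y → toℕ (lookup υ y)) xs
    cong-∈ τ υ eq = map-cong-∈ xs (cong toℕ ∘ eq)
    eqs : ∀ {y} → y Vec.∈ xs → lookup ρ y ≡ lookup σ y × lookup ρ′ y ≡ lookup σ′ y
    eqs {y} y∈ = Placed-≤ (pl y)
      (≤-trans (degreeBound-correct finite Eρ (here refl) x≤ (∈-map⁺ _ y∈))
               (≤-trans (sep lo) (N-mono lo<hi)))
  ... | inj₂ <x = subst E (map-cong-∈ xs λ {y} y∈ → cong toℕ (Placed-> (pl y) (≰⇒> λ y≤ →
                    <-irrefl refl (<-≤-trans <x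
                      (≤-trans (degreeBound-correct finite Eρ (∈-map⁺ _ y∈) y≤ (here refl))
                               (≤-trans (sep lo) (N-mono lo<hi))))))) Eρ

  -- Types and answers for a quantifier

  module Move {v K} (mid : ℕ) (κ₁ κ₂ : Vec (Fin n) (suc v) → Fin K) where

    LowMove : Vec (Fin n) v → Fin K → Set
    LowMove σ τ = ∃[ i ] (toℕ i ≤ N mid × κ₁ (i ∷ σ) ≡ τ)

    lowMove? : ∀ σ τ → Dec (LowMove σ τ)
    lowMove? σ τ = any? λ i → (toℕ i ≤? N mid) ×-dec (κ₁ (i ∷ σ) ≟ τ)

    lowMoves : Vec (Fin n) v → Fin (2 ^ K)
    lowMoves σ = funToFin λ τ → truthValue (lowMove? σ τ)

    -- The type is fixed before the move is known, so a high new variable enters `κ₂` as `junk`.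
    moveType : Vec (Fin n) v → Fin (2 ^ K * K)
    moveType σ = combine (lowMoves σ) (κ₂ (junk ∷ σ))

    -- A move beyond `N mid` is copied. A move up to `N mid` is answered by such an element of the
    -- same `κ₁`-type, which exists because equal move types offer equal sets of types. One answer
    -- serves both implications: `∃′` uses the first, `∀′` the second.
    respond : ∀ {φ lo hi} → lo ≤ mid → mid ≤ hi →
      Classifies φ mid hi κ₁ → Classifies φ lo mid κ₂ →
      ∀ {ρ ρ′ σ σ′} → AllPlaced lo hi ρ ρ′ σ σ′ → moveType σ ≡ moveType σ′ →
      ∀ i → ∃[ j ] ((w , i ∷ ρ ⊨ φ → w , j ∷ ρ′ ⊨ φ) × (w , j ∷ ρ′ ⊨ φ → w , i ∷ ρ ⊨ φ))
    respond {φ} lo≤mid mid≤hi cl₁ cl₂ {ρ} {ρ′} {σ} {σ′} pl eq i with toℕ i ≤? N mid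
    ... | no i≰ = i , cl₂ pl′ eq₂ , cl₂ (Placed-sym ∘ pl′) (sym eq₂)
      where
      eq₂ = combine-injectiveʳ (lowMoves σ) (κ₂ _) (lowMoves σ′) (κ₂ _) eq
      pl′ : AllPlaced _ mid (i ∷ ρ) (i ∷ ρ′) (junk ∷ σ) (junk ∷ σ′)
      pl′ = AllPlaced-∷ ≤-refl mid≤hi (high (≰⇒> i≰)) pl
    ... | yes i≤
      with j , j≤ , eq₁ ← truthValue-transfer (lowMove? σ _) (lowMove? σ′ _)
                            (funToFin-injective (combine-injectiveˡ (lowMoves σ) (κ₂ _) (lowMoves σ′) (κ₂ _) eq)
                              (κ₁ (i ∷ σ)))
                            (i , i≤ , refl)
      = j , cl₁ pl′ (sym eq₁) , cl₁ (Placed-sym ∘ pl′) eq₁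
      where
      pl′ : AllPlaced mid _ (i ∷ ρ) (j ∷ ρ′) (i ∷ σ) (j ∷ σ′)
      pl′ = AllPlaced-∷ lo≤mid ≤-refl (low i≤ j≤) pl

  -- Only a double negation, since the predicates need not be decidable.
  Classifiable : ∀ {v} → FO[≤, fin ] s v → (lo hi : ℕ) → Set
  Classifiable {v} φ lo hi = ¬ ¬ (Σ[ κ ∈ (Vec (Fin n) v → Fin (types φ)) ] Classifies φ lo hi κ)

  -- Types by induction on the formula

  atom-interval : ∀ {lo hi} → lo + 1 ≤ hi → suc lo ≤ hi
  atom-interval {lo} = ≤-trans (≤-reflexive (+-comm 1 lo))

  lookup-≤? : ∀ {v} (σ : Vec (Fin n) v) x y → Dec (toℕ (lookup σ x) ≤ toℕ (lookup σ y))
  lookup-≤? σ x y = toℕ (lookup σ x) ≤? toℕ (lookup σ y)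

  classifiable : ∀ {v} (φ : FO[≤, fin ] s v) {lo hi} → lo + gap φ ≤ hi → Separated φ →
    Classifiable φ lo hi

  classifiable₂ : ∀ {v} (φ ψ : FO[≤, fin ] s v) {lo hi} → lo + (gap φ + gap ψ) ≤ hi →
    (∀ i → reach φ (N i) + reach ψ (N i) ≤ N (suc i)) →
    ¬ ¬ (Σ[ κ ∈ (Vec (Fin n) v → Fin (types φ * types ψ)) ]
           Classifies φ lo hi κ × Classifies ψ lo hi κ)
  classifiable₂ φ ψ {lo} g≤ sep k =
    classifiable φ (≤-trans (+-monoʳ-≤ lo (m≤m+n _ _)) g≤)
      (λ i → ≤-trans (m≤m+n _ _) (sep i)) λ (κ , cl) →
    classifiable ψ (≤-trans (+-monoʳ-≤ lo (m≤n+m _ (gap φ))) g≤)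
      (λ i → ≤-trans (m≤n+m _ (reach φ (N i))) (sep i)) λ (μ , cm) →
    k ( (λ σ → combine (κ σ) (μ σ))
      , (λ pl eq → cl pl (combine-injectiveˡ (κ _) (μ _) _ _ eq))
      , (λ pl eq → cm pl (combine-injectiveʳ (κ _) (μ _) _ _ eq)))

  -- The interval is cut at `mid`. A low move leaves its upper part free, a high move its lower
  -- part, and either has room for `gap φ` thresholds.
  classifiable-move : ∀ {v} (φ : FO[≤, fin ] s (suc v)) {lo hi} → lo + (gap φ + gap φ) ≤ hi →
    Separated φ →
    ¬ ¬ (Σ[ κ ∈ (Vec (Fin n) v → Fin (2 ^ types φ * types φ)) ]
      (∀ {ρ ρ′ σ σ′} → AllPlaced lo hi ρ ρ′ σ σ′ → κ σ ≡ κ σ′ →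
       ∀ i → ∃[ j ] ((w , i ∷ ρ ⊨ φ → w , j ∷ ρ′ ⊨ φ) × (w , j ∷ ρ′ ⊨ φ → w , i ∷ ρ ⊨ φ))))
  classifiable-move φ {lo} {hi} g≤ sep k =
    classifiable φ mid+g≤hi sep λ (κ₁ , cl₁) →
    classifiable φ ≤-refl sep λ (κ₂ , cl₂) →
    k ( Move.moveType mid κ₁ κ₂
      , Move.respond mid κ₁ κ₂ {φ} (m≤m+n lo _) (≤-trans (m≤m+n mid _) mid+g≤hi) cl₁ cl₂)
    where
    mid = lo + gap φ
    mid+g≤hi : mid + gap φ ≤ hi
    mid+g≤hi = ≤-trans (≤-reflexive (+-assoc lo _ _)) g≤

  classifiable ⊤′ g≤ sep k = k ((λ _ → zero) , λ _ _ _ → _)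
  classifiable ⊥′ g≤ sep k = k ((λ _ → zero) , λ _ _ ())
  classifiable (letter a x) g≤ sep k =
    k ((λ _ → zero) , λ _ _ wx≡a → trans (constant _ _) wx≡a)
  classifiable (x ≼ y) g≤ sep k =
    k ( (λ σ → truthValue (lookup-≤? σ x y))
      , λ {_} {_} {σ} {σ′} pl eq → Placed-≼ (<⇒≤ (atom-interval g≤)) (pl x) (pl y)
          (truthValue-transfer (lookup-≤? σ x y) (lookup-≤? σ′ x y) eq))
  -- Equality is split into two inequalities, to which `Placed-≼` applies.
  classifiable (x ≐ y) g≤ sep k =
    k ( (λ σ → combine (truthValue (lookup-≤? σ x y)) (truthValue (lookup-≤? σ y x)))
      , λ {ρ} {ρ′} {σ} {σ′} pl eq x≡y → toℕ-injective (≤-antisym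
          (Placed-≼ lo≤hi (pl x) (pl y)
            (truthValue-transfer (lookup-≤? σ x y) (lookup-≤? σ′ x y) (combine-injectiveˡ _ _ _ _ eq))
            (≤-reflexive (cong toℕ x≡y)))
          (Placed-≼ lo≤hi (pl y) (pl x)
            (truthValue-transfer (lookup-≤? σ y x) (lookup-≤? σ′ y x)
              (combine-injectiveʳ (truthValue (lookup-≤? σ x y)) _ (truthValue (lookup-≤? σ′ x y)) _ eq))
            (≤-reflexive (cong toℕ (sym x≡y))))))
    where
    lo≤hi = <⇒≤ (atom-interval g≤)
  classifiable (pred E finite xs) g≤ sep k =
    -- Excluded middle is taken at all assignments at once, so that the truth value of `E` can serve
    -- as the type.
    ¬¬-∀-Vec {P = λ σ → Dec (E (map (λ x → toℕ (lookup σ x)) xs))} (λ _ → ¬¬-excluded-middle) λ E? →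
    k ( (λ σ → truthValue (E? σ))
      , λ {ρ} {ρ′} {σ} {σ′} pl eq →
          Placed-pred finite xs sep (atom-interval g≤) {ρ} {ρ′} {σ} {σ′} pl
            (truthValue-transfer (E? σ) (E? σ′) eq))
  classifiable (¬′ φ) g≤ sep k =
    classifiable φ g≤ sep λ (κ , cl) →
    k (κ , λ pl eq ¬φ φ′ → ¬φ (cl (Placed-sym ∘ pl) (sym eq) φ′))
  classifiable (φ ∧′ ψ) g≤ sep k =
    classifiable₂ φ ψ g≤ sep λ (κ , cl , cm) →
    k (κ , λ { pl eq (p , q) → cl pl eq p , cm pl eq q })
  classifiable (φ ∨′ ψ) g≤ sep k =
    classifiable₂ φ ψ g≤ sep λ (κ , cl , cm) →
    k (κ , λ { pl eq (inj₁ p) → inj₁ (cl pl eq p) ; pl eq (inj₂ q) → inj₂ (cm pl eq q) })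
  classifiable (φ ⇒′ ψ) g≤ sep k =
    classifiable₂ φ ψ g≤ sep λ (κ , cl , cm) →
    k (κ , λ pl eq p⇒q p → cm pl eq (p⇒q (cl (Placed-sym ∘ pl) (sym eq) p)))
  classifiable (∃′ φ) g≤ sep k =
    classifiable-move φ g≤ sep λ (κ , respond) →
    k (κ , λ { pl eq (i , p) → map₂ (λ (to , _) → to p) (respond pl eq i) })
  classifiable (∀′ φ) g≤ sep k =
    classifiable-move φ g≤ sep λ (κ , respond) →
    k (κ , λ pl eq p i →
      -- The challenge `i` comes in the second play, so the plays are swapped and `j` answers in the
      -- first.
      let j , _ , from = respond (Placed-sym ∘ pl) (sym eq) i in from (p j))

-- Pigeonhole on a sequence of candidates

proposition4 : (f : ℕ → ℕ) → Nondecreasing f → Unbounded f → (∀ n → f n ≤ n) →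
    ¬ (FO[≤, fin ]SumsThrough f)
proposition4 f f-mono f-unbounded _ (φ , sums) =
  -- The goal is absurdity, so the double negation can be opened.
  classifiable φ {0} {gap φ} ≤-refl sep λ (κ , cl) →
    -- There is one candidate more than there are types. The two `zero`s hide the high variables
    -- from `κ`.
    let i , j , i<j , eq = pigeonhole (n<1+n (types φ)) λ k → κ (zero ∷ zero ∷ C k ∷ [])
        holds = Equivalence.from (sums n w (A i) B (C i)) (A-sum i)
        fails = Equivalence.to (sums n w (A i) B (C j)) (cl (placed i j) eq holds)
        fc-eq = +-cancelˡ-≡ (toℕ B) _ _ (trans (sym (A-sum i)) fails)
    in <-irrefl (subst (λ m → m ≡ f (toℕ (C j))) (cong f (toℕ-C i)) fc-eq)
         (subst (λ m → f (c (toℕ i)) < f m) (sym (toℕ-C j)) (step-mono⇒mono-< fc-step i<j))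
  where
  c : ℕ → ℕ
  c zero    = 0
  c (suc i) = proj₁ (f-unbounded (f (c i)))

  fc-step : ∀ i → f (c i) < f (c (suc i))
  fc-step i = proj₂ (f-unbounded (f (c i)))

  c-step : ∀ i → c i ≤ c (suc i)
  -- Otherwise monotonicity would give `f (c (suc i)) ≤ f (c i)`.
  c-step i = ≮⇒≥ λ c> → <-irrefl refl (<-≤-trans (fc-step i) (f-mono c>))

  -- All candidates lie up to `N 0`; adding the reach makes the thresholds both nondecreasing and
  -- separated.
  N : ℕ → ℕ
  N zero    = c (types φ)
  N (suc i) = N i + reach φ (N i)

  N-step : ∀ i → N i ≤ N (suc i)
  N-step i = m≤m+n _ _

  sep : ∀ i → reach φ (N i) ≤ N (suc i)
  sep i = m≤n+m _ (N i)

  -- `b` is the first position beyond `N (gap φ)`, and `n` leaves room for the largest sum.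
  b n : ℕ
  b = suc (N (gap φ))
  n = suc (b + f (c (types φ)))

  w : Word 2 n
  w = replicate n zero

  open Game w (λ i j → trans (lookup-replicate i zero) (sym (lookup-replicate j zero))) zero N N-step

  index≤ : (i : Fin (suc (types φ))) → toℕ i ≤ types φ
  index≤ i with s≤s i≤ ← toℕ<n i = i≤

  c≤ : ∀ (i : Fin (suc (types φ))) → c (toℕ i) ≤ N 0
  c≤ i = step-mono⇒mono c-step (index≤ i)

  b<n : b < n
  b<n = s≤s (m≤m+n _ _)

  c<n : ∀ i → c (toℕ i) < n
  c<n i = ≤-<-trans (≤-trans (c≤ i) (≤-trans (N-mono {j = gap φ} z≤n) (<⇒≤ (n<1+n _)))) b<n

  a<n : ∀ (i : Fin (suc (types φ))) → b + f (c (toℕ i)) < n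
  a<n i = s≤s (+-monoʳ-≤ b (step-mono⇒mono (<⇒≤ ∘ fc-step) (index≤ i)))

  B : Fin n
  B = fromℕ< b<n

  A C : Fin (suc (types φ)) → Fin n
  A i = fromℕ< (a<n i)
  C i = fromℕ< (c<n i)

  toℕ-C : ∀ i → toℕ (C i) ≡ c (toℕ i)
  toℕ-C i = toℕ-fromℕ< (c<n i)

  A-sum : ∀ i → toℕ (A i) ≡ toℕ B + f (toℕ (C i))
  A-sum i = trans (toℕ-fromℕ< (a<n i))
    (sym (cong₂ (λ x y → x + f y) (toℕ-fromℕ< b<n) (toℕ-C i)))

  placed : ∀ i j → AllPlaced 0 (gap φ) (A i ∷ B ∷ C i ∷ []) (A i ∷ B ∷ C j ∷ [])
                             (zero ∷ zero ∷ C i ∷ []) (zero ∷ zero ∷ C j ∷ [])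
  placed i j zero             = high (<-≤-trans (n<1+n _)
    (≤-trans (m≤m+n b _) (≤-reflexive (sym (toℕ-fromℕ< (a<n i))))))
  placed i j (suc zero)       = high (≤-reflexive (sym (toℕ-fromℕ< b<n)))
  placed i j (suc (suc zero)) = low (C≤ i) (C≤ j)
    where
    C≤ : ∀ k → toℕ (C k) ≤ N 0
    C≤ k = ≤-trans (≤-reflexive (toℕ-C k)) (c≤ k)
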